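{- Let $(W,S)$ be a Coxeter system. Consider a random walk on $W$ started at the identity $1_W$ which, at each step, multiplies the current element on the right by $s\in S$ with probability $p_s$, or by $1_W$ with probability $p_{\mathrm{id}}$ (where $p_{\mathrm{id}}+\sum_{s\in S} p_s = 1$). Suppose $p_s < p_{\mathrm{id}}$ for every $s\in S$. Let $P^n(x)$ be the probability that the walk is at $x\in W$ after $n$ steps. Then for every $n\ge 0$ and all $w,w'\in W$ with $w\leq_B w'$, we have $P^n(w)\geq P^n(w')$.
   Context: A Coxeter system $(W,S)$ is a group $W$ with generating set $S=\{s_1,\dots,s_k\}$ and presentation $\langle s_1,\dots,s_k \mid s_i^2,\ (s_is_j)^{m_{ij}}\ (i\neq j)\rangle$, where each $m_{ij}$ ($i\ne j$) is an integer $\geq 2$ or $\infty$. The (right) weak Bruhat order $\leq_B$ on $W$ is defined by $w \leq_B w'$ iff there is a reduced word for $w$ which can be extended by multiplying on the right by elements of $S$ to obtain a reduced word for $w'$; equivalently, some shortest path from $1_W$ to $w'$ in the Cayley graph $\Gamma(W,S)$ passes through $w$. -}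

module Defs where

open import Level using (Level; _⊔_) renaming (suc to lsuc)
open import Data.Nat using (ℕ; zero; suc; _≤_; _≥_)
open import Data.Fin using (Fin; zero; suc)
open import Data.List using (List; []; _∷_; _++_; length; concat; replicate; map; foldr; allFin)
open import Data.Vec using (Vec; []; _∷_)
open import Data.Maybe using (Maybe; just; nothing)
open import Data.Product using (Σ; ∃; ∃-syntax; _×_; _,_)
open import Data.Sum using (_⊎_)
open import Relation.Nullary using (¬_; Dec; yes; no)
open import Relation.Binary.PropositionalEquality using (_≡_)
open import Relation.Binary.Structures using (IsTotalOrder)
open import Algebra.Bundles using (CommutativeRing)

-- A Coxeter matrix on k generators s_0,…,s_{k-1}:
-- m i j = just n  means m_ij = n,  m i j = nothing  means m_ij = ∞.
record CoxeterMatrix (k : ℕ) : Set where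
  field
    m       : Fin k → Fin k → Maybe ℕ
    m-sym   : ∀ i j → m i j ≡ m j i
    m-≥2    : ∀ i j → ¬ (i ≡ j) → ∀ n → m i j ≡ just n → n ≥ 2

module Coxeter {k : ℕ} (M : CoxeterMatrix k) where
  open CoxeterMatrix M

  Word : Set
  Word = List (Fin k)

  data Relator : Word → Set where
    sq   : ∀ i → Relator (i ∷ i ∷ [])
    braid : ∀ i j n → ¬ (i ≡ j) → m i j ≡ just n →
            Relator (concat (replicate n (i ∷ j ∷ [])))

  data _≈W_ : Word → Word → Set where
    rel    : ∀ u r v → Relator r → (u ++ r ++ v) ≈W (u ++ v)
    ≈refl  : ∀ {u} → u ≈W u
    ≈sym   : ∀ {u v} → u ≈W v → v ≈W u
    ≈trans : ∀ {u v w} → u ≈W v → v ≈W w → u ≈W w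

  Reduced : Word → Set
  Reduced u = ∀ v → v ≈W u → length u ≤ length v

  -- right weak Bruhat order on (elements represented by) words:
  -- some reduced word for w' has a prefix which is a word for w
  -- (a prefix of a reduced word is itself reduced).
  _≤B_ : Word → Word → Set
  w ≤B w' = ∃[ u ] ∃[ v ] (u ≈W w × (u ++ v) ≈W w' × Reduced (u ++ v))

-- Ordered fields (the probabilities live in an ordered field; the reals
-- are the intended instance)

record OrderedField (c ℓ : Level) : Set (lsuc (c ⊔ ℓ)) where
  field
    commutativeRing : CommutativeRing c ℓ
  open CommutativeRing commutativeRing public
  field
    _≤F_          : Carrier → Carrier → Set ℓ
    ≤F-isTotalOrder : IsTotalOrder _≈_ _≤F_
    ≤F-+-mono     : ∀ {a b} c → a ≤F b → (a + c) ≤F (b + c)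
    ≤F-*-nonneg   : ∀ {a b} → 0# ≤F a → 0# ≤F b → 0# ≤F (a * b)
    0≉1           : ¬ (0# ≈ 1#)
    inverse       : ∀ x → ¬ (x ≈ 0#) → ∃[ y ] (x * y ≈ 1#)

  _<F_ : Carrier → Carrier → Set ℓ
  a <F b = a ≤F b × ¬ (a ≈ b)

module Walk {c ℓ : Level} (F : OrderedField c ℓ) {k : ℕ} (M : CoxeterMatrix k) where
  open OrderedField F
  open Coxeter M

  -- a step is an element of Fin (suc k): zero = multiply by 1_W,
  -- suc s = multiply on the right by the generator s
  Step : Set
  Step = Fin (suc k)

  paths : (n : ℕ) → List (Vec Step n)
  paths zero    = [] ∷ []
  paths (suc n) = concat (map (λ a → map (a ∷_) (paths n)) (allFin (suc k)))

  pathWord : ∀ {n} → Vec Step n → Word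
  pathWord []            = []
  pathWord (zero  ∷ as)  = pathWord as
  pathWord (suc s ∷ as)  = s ∷ pathWord as

  sumF : List Carrier → Carrier
  sumF = foldr _+_ 0#

  module _ (p : Fin k → Carrier) (pid : Carrier) where
    stepProb : Step → Carrier
    stepProb zero    = pid
    stepProb (suc s) = p s

    pathProb : ∀ {n} → Vec Step n → Carrier
    pathProb []       = 1#
    pathProb (a ∷ as) = stepProb a * pathProb as

    module _ (dec : ∀ u v → Dec (u ≈W v)) where
      P : ℕ → Word → Carrier
      P n x = sumF (map (λ π → indicator (dec (pathWord π) x) (pathProb π)) (paths n))
        where
        indicator : ∀ {A : Set} → Dec A → Carrier → Carrier
        indicator (yes _) r = r
        indicator (no _)  _ = 0#

{-# OPTIONS --safe #-}

-- Let ρ(w, s) be the parity of the number of times the reflection w s w⁻¹ occurs among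
-- the inversions of w; the defining relations preserve it, and ρ(w, s) = 0 whenever
-- w s is longer than w. By induction on n, ρ(w, s) = 0 implies Pⁿ(ws) ≤ Pⁿ(w):
-- condition on the first step, so that Pⁿ⁺¹(w) = p_id Pⁿ(w) + Σ_t p_t Pⁿ(tw). If tw ≠ ws then
-- ρ(tw, s) = 0 and Pⁿ(tws) ≤ Pⁿ(tw). If tw = ws, then t and the identity swap the
-- contributions of w and ws, and p_t ≤ p_id gives the inequality, since only one t can
-- satisfy tw = ws. This last point needs that distinct generators are distinct in W, for
-- which W is made to act in characteristic 2: firing node s adds (1 + Z_st) f_s to f_t,
-- where Z_st = Z_ts⁻¹ has order m_st and no nonzero fixed vector if m_st is odd, and is
-- the identity otherwise. An extra node, to which every firing of s adds f_s, separates
-- the generators.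
module Submission where

open import Defs
open import Level using (Level)
import Algebra.Solver.Ring.NaturalCoefficients.Default as SemiringSolver
open import Data.Bool using (Bool; true; false; _xor_; _∧_)
open import Data.Bool.Properties using (xor-same; xor-assoc; xor-identityʳ; ∧-zeroʳ; ∧-comm; ¬-not)
open import Data.Bool.Solver using (module xor-∧-Solver)
open import Data.Fin as Fin using (Fin; zero; suc; combine; remQuot)
open import Data.Fin.Properties using (_≟_; <-cmp; remQuot-combine)
open import Data.List using (List; []; _∷_; _++_; length; concat; replicate; map; allFin; tabulate)
open import Data.List.Properties using (++-assoc; ++-identityʳ; length-++; map-cong; map-tabulate; map-∘; map-++)
open import Data.List.Relation.Unary.All as All using (All; []; _∷_)
open import Data.List.Relation.Unary.AllPairs using ([]; _∷_)
open import Data.List.Relation.Unary.Unique.Propositional using (Unique)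
open import Data.List.Relation.Unary.Unique.Propositional.Properties using (allFin⁺)
open import Data.Maybe using (Maybe; just; nothing)
open import Data.Nat using (ℕ; zero; suc)
open import Data.Nat.Divisibility using (_∣?_; ∣m∣n⇒∣m+n; ∣m+n∣m⇒∣n; ∣-refl; _∣0; >⇒∤)
import Data.Nat as ℕ
import Data.Nat.Properties as ℕ
open import Data.Product using (∃-syntax; _×_; _,_; proj₁; proj₂; uncurry)
open import Data.Sum using (_⊎_; inj₁; inj₂)
open import Data.Vec as Vec using (Vec; []; _∷_; updateAt)
open import Data.Vec.Properties using (updateAt-id-local; updateAt-updateAt-local)
open import Function using (_∘_; id; mk⇔)
open import Relation.Binary.Definitions using (tri<; tri≈; tri>)
import Relation.Binary.PropositionalEquality as ≡
open ≡ using (_≡_; _≢_)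
open import Relation.Binary.Structures using (IsTotalOrder)
open import Relation.Nullary using (¬_; Dec; yes; no; does; contradiction)
open import Relation.Nullary.Decidable using (does-⇔; dec-true; dec-false)

-- Sums over the field of two elements, and functions on integer vectors.

module CharacteristicTwo where
  open ≡
  open import Data.Nat using (_+_; _*_; s≤s; z≤n)
  open import Data.Nat.Properties using (+-comm; +-assoc; +-suc; *-comm)
  open xor-∧-Solver using (solve; _:+_; _:=_)

  ⨁ : ℕ → (ℕ → Bool) → Bool
  ⨁ zero    f = false
  ⨁ (suc n) f = ⨁ n f xor f n

  ⨁-cong : ∀ n {f g : ℕ → Bool} → (∀ c → f c ≡ g c) → ⨁ n f ≡ ⨁ n g
  ⨁-cong zero    eq = refl
  ⨁-cong (suc n) eq = cong₂ _xor_ (⨁-cong n eq) (eq n)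

  ⨁-xor : ∀ n (f g : ℕ → Bool) → ⨁ n (λ c → f c xor g c) ≡ ⨁ n f xor ⨁ n g
  ⨁-xor zero    f g = refl
  ⨁-xor (suc n) f g = trans (cong (_xor (f n xor g n)) (⨁-xor n f g))
    (solve 4 (λ a b c d → (a :+ b) :+ (c :+ d) := (a :+ c) :+ (b :+ d)) refl
      (⨁ n f) (⨁ n g) (f n) (g n))

  ⨁-∧ : ∀ n b (f : ℕ → Bool) → ⨁ n (λ c → b ∧ f c) ≡ b ∧ ⨁ n f
  ⨁-∧ n true  f = refl
  ⨁-∧ zero false f = refl
  ⨁-∧ (suc n) false f = cong (_xor false) (⨁-∧ n false f)

  ⨁-+ : ∀ m n (f : ℕ → Bool) → ⨁ (m + n) f ≡ ⨁ n f xor ⨁ m (λ c → f (c + n))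
  ⨁-+ zero    n f = sym (xor-identityʳ _)
  ⨁-+ (suc m) n f = trans (cong (_xor f (m + n)) (⨁-+ m n f)) (xor-assoc (⨁ n f) _ _)

  ⨁-telescope : ∀ n (f : ℕ → Bool) → ⨁ n (λ c → f c xor f (suc c)) ≡ f 0 xor f n
  ⨁-telescope zero    f = sym (xor-same (f 0))
  ⨁-telescope (suc n) f = trans (cong (_xor (f n xor f (suc n))) (⨁-telescope n f))
    (solve 3 (λ a b c → (a :+ b) :+ (b :+ c) := a :+ c) refl (f 0) (f n) (f (suc n)))

  ⨁-const-even : ∀ h b → ⨁ (h + h) (λ _ → b) ≡ false
  ⨁-const-even h b = trans (⨁-+ h h (λ _ → b)) (xor-same (⨁ h (λ _ → b)))

  xor≡false⇒≡ : ∀ {a b} → a xor b ≡ false → a ≡ b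
  xor≡false⇒≡ {true}  {true}  _ = refl
  xor≡false⇒≡ {false} {false} _ = refl

  -- starts at 3: an off-diagonal Coxeter exponent is never 1
  odd : ℕ → ℕ
  odd h = 3 + (h + h)

  ⨁-const-odd : ∀ h b → ⨁ (odd h) (λ _ → b) ≡ b
  ⨁-const-odd h b = trans (cong (λ z → ((z xor b) xor b) xor b) (⨁-const-even h b))
    (solve 1 (λ b → (b :+ b) :+ b := b) refl b)

  data Parity : ℕ → Set where
    isEven : ∀ h → Parity (h + h)
    isOne  : Parity 1
    isOdd  : ∀ h → Parity (odd h)

  parity : ∀ n → Parity n
  parity 0 = isEven 0
  parity 1 = isOne
  parity (suc (suc n)) with parity n
  ... | isEven h = subst Parity (cong suc (+-suc h h)) (isEven (suc h))
  ... | isOne    = isOdd 0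
  ... | isOdd h  = subst Parity (cong (4 +_) (+-suc h h)) (isOdd (suc h))

  -- Precomposing a function with `shift p r` applies the r-th power of the unit shift Z in
  -- coordinate `p`. Exponents are natural numbers, so where Z has order n its inverse is written as
  -- the power n - 1.
  shift : ∀ {N} → Fin N → ℕ → Vec ℕ N → Vec ℕ N
  shift p r a = updateAt a p (r +_)

  shift-0 : ∀ {N} (p : Fin N) a → shift p 0 a ≡ a
  shift-0 p a = updateAt-id-local p a refl

  shift-shift : ∀ {N} (p : Fin N) r s a → shift p r (shift p s a) ≡ shift p (r + s) a
  shift-shift p r s a = updateAt-updateAt-local p a (sym (+-assoc r s _))

  shift-comm : ∀ {N} (p q : Fin N) r s a → shift p r (shift q s a) ≡ shift q s (shift p r a)
  shift-comm zero    zero    r s (x ∷ a) = cong (_∷ a)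
    (trans (sym (+-assoc r s x)) (trans (cong (_+ x) (+-comm r s)) (+-assoc s r x)))
  shift-comm zero    (suc q) r s (x ∷ a) = refl
  shift-comm (suc p) zero    r s (x ∷ a) = refl
  shift-comm (suc p) (suc q) r s (x ∷ a) = cong (x ∷_) (shift-comm p q r s a)

  shift-suc : ∀ {N} (p : Fin N) r c a → shift p (c * r) (shift p r a) ≡ shift p (suc c * r) a
  shift-suc p r c a = trans (shift-shift p (c * r) r a)
    (cong (λ z → shift p z a) (+-comm (c * r) r))

  -- The functions that, in each coordinate of prescribed odd order n, are killed
  -- by 1 + Z + … + Z^{n-1}, where Z is the unit shift: on them Z has
  -- order n and no nonzero fixed vector.
  module Balanced {N : ℕ} (order : Fin N → Maybe ℕ) where

    Index : Set
    Index = Vec ℕ N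

    record IsBalanced (f : Index → Bool) : Set where
      field window-sum : ∀ p h → order p ≡ just h → ∀ a → ⨁ (odd h) (λ c → f (shift p c a)) ≡ false
    open IsBalanced

    false-balanced : IsBalanced (λ _ → false)
    false-balanced .window-sum p h _ a = trans (⨁-cong (odd h) (λ _ → refl)) (⨁-∧ (odd h) false (λ _ → false))

    xor-balanced : ∀ {f g} → IsBalanced f → IsBalanced g → IsBalanced (λ a → f a xor g a)
    xor-balanced bf bg .window-sum p h eq a =
      trans (⨁-xor (odd h) _ _) (cong₂ _xor_ (window-sum bf p h eq a) (window-sum bg p h eq a))

    shift-balanced : ∀ {f} q r → IsBalanced f → IsBalanced (f ∘ shift q r)
    shift-balanced {f} q r bf .window-sum p h eq a =
      trans (⨁-cong (odd h) (λ c → cong f (shift-comm q p r c a))) (window-sum bf p h eq (shift q r a))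

    ⨁-balanced : ∀ n (f : ℕ → Index → Bool) → (∀ c → IsBalanced (f c)) →
                 IsBalanced (λ a → ⨁ n (λ c → f c a))
    ⨁-balanced zero    f bf = false-balanced
    ⨁-balanced (suc n) f bf = xor-balanced (⨁-balanced n f bf) (bf n)

    module _ {p : Fin N} {h : ℕ} (odd-p : order p ≡ just h) where

      private
        n = odd h

        ∑ : ℕ → (Index → Bool) → ℕ → Index → Bool
        ∑ c f r a = ⨁ c (λ d → f (shift p (d * r) a))

      -- The sum of F c + F (c + 1) over a window telescopes to F 0 + F n. It is also the sum of two
      -- window sums, one based at `a` and one at its unit shift, and both vanish.
      shift-period : ∀ {f} → IsBalanced f → ∀ a → f (shift p n a) ≡ f a
      shift-period {f} bf a = trans (sym F0≡Fn) (cong f (shift-0 p a))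
        where
        F : ℕ → Bool
        F c = f (shift p c a)

        F-suc : ∀ c → F (suc c) ≡ f (shift p c (shift p 1 a))
        F-suc c = cong f (sym (trans (shift-shift p c 1 a) (cong (λ z → shift p z a) (+-comm c 1))))

        F0≡Fn : F 0 ≡ F n
        F0≡Fn = xor≡false⇒≡ (begin
          F 0 xor F n                                          ≡⟨ ⨁-telescope n F ⟨
          ⨁ n (λ c → F c xor F (suc c))                        ≡⟨ ⨁-xor n F (F ∘ suc) ⟩
          ⨁ n F xor ⨁ n (F ∘ suc)                              ≡⟨ cong (⨁ n F xor_) (⨁-cong n F-suc) ⟩
          ⨁ n F xor ⨁ n (λ c → f (shift p c (shift p 1 a)))    ≡⟨ cong₂ _xor_ (window-sum bf p h odd-p a)
                                                                          (window-sum bf p h odd-p (shift p 1 a)) ⟩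
          false                                                ∎)
          where open ≡-Reasoning

      shift-multiple : ∀ {f} → IsBalanced f → ∀ r a → f (shift p (r * n) a) ≡ f a
      shift-multiple {f} bf zero    a = cong f (shift-0 p a)
      shift-multiple {f} bf (suc r) a = trans (cong f (sym (shift-shift p n (r * n) a)))
        (trans (shift-period bf _) (shift-multiple bf r a))

      -- On a function fixed by Z, a window sum adds an odd number of copies of one value, so it
      -- equals that value; balance makes it zero.
      fixed₁⇒false : ∀ {f} → IsBalanced f → (∀ a → f (shift p 1 a) ≡ f a) → ∀ a → f a ≡ false
      fixed₁⇒false {f} bf fix a = trans (sym (⨁-const-odd h (f a)))
        (trans (⨁-cong n (λ c → sym (fixed-c c))) (window-sum bf p h odd-p a))
        where
        fixed-c : ∀ c → f (shift p c a) ≡ f a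
        fixed-c zero    = cong f (shift-0 p a)
        fixed-c (suc c) = trans (cong f (sym (shift-shift p 1 c a))) (trans (fix _) (fixed-c c))

      -- The exponents of Z and of its inverse, the only nontrivial twists that occur.
      IsUnit : ℕ → Set
      IsUnit r = r ≡ 1 ⊎ suc r ≡ n

      fixed⇒false : ∀ {f r} → IsUnit r → IsBalanced f →
                    (∀ a → f (shift p r a) ≡ f a) → ∀ a → f a ≡ false
      fixed⇒false         (inj₁ refl) bf fix = fixed₁⇒false bf fix
      -- Being fixed by the power n - 1 implies being fixed by Z, since the n-th power acts
      -- trivially.
      fixed⇒false {f} {r} (inj₂ refl) bf fix = fixed₁⇒false bf λ a →
        trans (sym (fix (shift p 1 a)))
          (trans (cong f (trans (shift-shift p r 1 a) (cong (λ z → shift p z a) (+-comm r 1))))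
                 (shift-period bf a))

      -- Adding the sum to its own shift by `r` telescopes to f + f shifted by n * r, which is zero
      -- by periodicity. The sum is therefore a balanced function fixed by the twist, hence zero.
      geometric-sum : ∀ {f r} → IsUnit r → IsBalanced f → ∀ a → ∑ n f r a ≡ false
      geometric-sum {f} {r} unit bf = fixed⇒false {r = r} unit
        (⨁-balanced n (λ c → f ∘ shift p (c * r)) (λ c → shift-balanced p (c * r) bf)) fix
        where
        fix : ∀ a → ∑ n f r (shift p r a) ≡ ∑ n f r a
        fix a = sym (xor≡false⇒≡ (begin
          ∑ n f r a xor ∑ n f r (shift p r a)
            ≡⟨ cong (∑ n f r a xor_) (⨁-cong n (λ c → cong f (shift-suc p r c a))) ⟩
          ∑ n f r a xor ⨁ n (λ c → f (shift p (suc c * r) a))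
            ≡⟨ ⨁-xor n _ _ ⟨
          ⨁ n (λ c → f (shift p (c * r) a) xor f (shift p (suc c * r) a))
            ≡⟨ ⨁-telescope n (λ c → f (shift p (c * r) a)) ⟩
          f (shift p 0 a) xor f (shift p (n * r) a)
            ≡⟨ cong₂ _xor_ (cong f (shift-0 p a))
                 (trans (cong (λ z → f (shift p z a)) (*-comm n r)) (shift-multiple bf r a)) ⟩
          f a xor f a
            ≡⟨ xor-same (f a) ⟩
          false ∎))
          where open ≡-Reasoning

  -- For `just h` this is the function of period n = `odd h` supported on the residues 0 and -1.
  -- These differ because n is at least 3, so each window of length n holds exactly two ones.
  pulse : Maybe ℕ → ℕ → Bool
  pulse nothing  a = true
  pulse (just h) a = does (odd h ∣? a) xor does (odd h ∣? suc a)

  pulse-sum : ∀ h a → ⨁ (odd h) (λ c → pulse (just h) (c + a)) ≡ false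
  pulse-sum h a = begin
    ⨁ n (λ c → D (c + a) xor D (suc c + a))  ≡⟨ ⨁-telescope n (λ c → D (c + a)) ⟩
    D a xor D (n + a)                         ≡⟨ cong (D a xor_) period ⟩
    D a xor D a                               ≡⟨ xor-same (D a) ⟩
    false                                     ∎
    where
    open ≡-Reasoning
    n = odd h
    D : ℕ → Bool
    D c = does (n ∣? c)
    period : D (n + a) ≡ D a
    period = does-⇔ (mk⇔ (λ d → ∣m+n∣m⇒∣n d ∣-refl) (∣m∣n⇒∣m+n ∣-refl)) (n ∣? (n + a)) (n ∣? a)

  pulse-0 : ∀ o → pulse o 0 ≡ true
  pulse-0 nothing  = refl
  pulse-0 (just h) = cong₂ _xor_ (dec-true (odd h ∣? 0) (odd h ∣0))
    (dec-false (odd h ∣? 1) (>⇒∤ (s≤s (s≤s z≤n))))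

  -- A product of pulses, one per coordinate: a balanced function that is nonzero at the origin. A
  -- window in one coordinate moves only the factor of that coordinate.
  weight : ∀ N → (Fin N → Maybe ℕ) → Vec ℕ N → Bool
  weight zero    o []      = true
  weight (suc N) o (x ∷ a) = pulse (o zero) x ∧ weight N (o ∘ suc) a

  open Balanced.IsBalanced

  weight-balanced : ∀ N o → Balanced.IsBalanced o (weight N o)
  weight-balanced (suc N) o .window-sum zero h eq (x ∷ a) rewrite eq = begin
    ⨁ n (λ c → pulse (just h) (c + x) ∧ b)  ≡⟨ ⨁-cong n (λ c → ∧-comm _ b) ⟩
    ⨁ n (λ c → b ∧ pulse (just h) (c + x))  ≡⟨ ⨁-∧ n b _ ⟩
    b ∧ ⨁ n (λ c → pulse (just h) (c + x))  ≡⟨ cong (b ∧_) (pulse-sum h x) ⟩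
    b ∧ false                                ≡⟨ ∧-zeroʳ b ⟩
    false                                    ∎
    where
    open ≡-Reasoning
    n = odd h
    b = weight N (o ∘ suc) a
  weight-balanced (suc N) o .window-sum (suc p) h eq (x ∷ a) = begin
    ⨁ (odd h) (λ c → pulse (o zero) x ∧ weight N (o ∘ suc) (shift p c a))
      ≡⟨ ⨁-∧ (odd h) (pulse (o zero) x) _ ⟩
    pulse (o zero) x ∧ ⨁ (odd h) (λ c → weight N (o ∘ suc) (shift p c a))
      ≡⟨ cong (pulse (o zero) x ∧_) (window-sum (weight-balanced N (o ∘ suc)) p h eq a) ⟩
    pulse (o zero) x ∧ false
      ≡⟨ ∧-zeroʳ _ ⟩
    false ∎
    where open ≡-Reasoning

  weight-0 : ∀ N o → weight N o (Vec.replicate N 0) ≡ true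
  weight-0 zero    o = refl
  weight-0 (suc N) o = cong₂ _∧_ (pulse-0 (o zero)) (weight-0 N (o ∘ suc))

  -- `just h` encodes a twist of order `odd h`; even and infinite exponents give `nothing`, an
  -- identity twist.
  oddOrder : Maybe ℕ → Maybe ℕ
  oddOrder nothing  = nothing
  oddOrder (just n) with parity n
  ... | isOdd h = just h
  ... | _       = nothing

  oddOrder-cases : ∀ n → n ≢ 1 → (∃[ h ] n ≡ h + h × oddOrder (just n) ≡ nothing)
                               ⊎ (∃[ h ] n ≡ odd h × oddOrder (just n) ≡ just h)
  oddOrder-cases n n≢1 with parity n
  ... | isEven h = inj₁ (h , refl , refl)
  ... | isOne    = contradiction refl n≢1
  ... | isOdd h  = inj₂ (h , refl , refl)

-- A representation of W in characteristic 2 that separates the generators.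

module DistinctGenerators {k : ℕ} (M : CoxeterMatrix k) where
  open CoxeterMatrix M
  open Coxeter M
  open CharacteristicTwo
  open ≡
  open import Data.Nat using (_+_; _*_; s≤s)
  open import Data.Nat.Properties using (+-comm)
  open xor-∧-Solver using (solve; _:+_; _:=_)

  -- Each unordered pair of distinct generators owns the coordinate of its increasing ordering; the
  -- other coordinates carry no window condition.
  pairOrder : Fin k → Fin k → Maybe ℕ
  pairOrder i j with <-cmp i j
  ... | tri< _ _ _ = oddOrder (m i j)
  ... | _          = nothing

  order : Fin (k * k) → Maybe ℕ
  order = uncurry pairOrder ∘ remQuot k

  open Balanced order

  -- Z_ij as a power of the unit shift in the coordinate of the pair {i, j}
  twist : Fin k → Fin k → Fin (k * k) × ℕ
  twist i j with <-cmp i j | oddOrder (m i j)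
  ... | tri< _ _ _ | just h  = combine i j , 1
  ... | tri> _ _ _ | just h  = combine j i , 2 + (h + h)
  ... | _          | _       = combine i j , 0

  σ : Fin k → Fin k → Index → Index
  σ i j = uncurry shift (twist i j)

  untwisted : ∀ i j → proj₂ (twist i j) ≡ 0 → ∀ a → σ i j a ≡ a
  untwisted i j eq a = trans (cong (λ r → shift (proj₁ (twist i j)) r a) eq) (shift-0 _ a)

  -- Makes the coefficient 1 + Z_ii vanish, so firing `i` leaves node `i` itself unchanged.
  twist-diagonal : ∀ i → proj₂ (twist i i) ≡ 0
  twist-diagonal i with <-cmp i i | oddOrder (m i i)
  ... | tri< _ i≢i _ | just h  = contradiction refl i≢i
  ... | tri> _ i≢i _ | just h  = contradiction refl i≢i
  ... | tri≈ _ _ _   | just h  = refl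
  ... | tri< _ _ _   | nothing = refl
  ... | tri> _ _ _   | nothing = refl
  ... | tri≈ _ _ _   | nothing = refl

  twist-even : ∀ i j → oddOrder (m i j) ≡ nothing → proj₂ (twist i j) ≡ 0
  twist-even i j eq with <-cmp i j | oddOrder (m i j)
  ... | tri< _ _ _   | nothing = refl
  ... | tri> _ _ _   | nothing = refl
  ... | tri≈ _ _ _   | nothing = refl

  -- Z_ij and Z_ji are powers of one unit shift whose exponents add up to its order, so they are
  -- mutually inverse on balanced functions.
  record Twisted (h : ℕ) (i j : Fin k) : Set where
    field
      coordinate  : Fin (k * k)
      has-order   : order coordinate ≡ just h
      amount₁     : ℕ
      amount₂     : ℕ
      twist₁      : twist i j ≡ (coordinate , amount₁)
      twist₂      : twist j i ≡ (coordinate , amount₂)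
      unit₁       : IsUnit has-order amount₁
      unit₂       : IsUnit has-order amount₂
      total       : amount₁ + amount₂ ≡ odd h

  twist-< : ∀ i j {h} → i Fin.< j → oddOrder (m i j) ≡ just h → twist i j ≡ (combine i j , 1)
  twist-< i j i<j eq with <-cmp i j | oddOrder (m i j)
  twist-< i j i<j refl | tri< _ _ _   | just h = refl
  ... | tri≈ i≮j _ _ | just h = contradiction i<j i≮j
  ... | tri> i≮j _ _ | just h = contradiction i<j i≮j

  twist-> : ∀ i j {h} → j Fin.< i → oddOrder (m i j) ≡ just h →
            twist i j ≡ (combine j i , 2 + (h + h))
  twist-> i j j<i eq with <-cmp i j | oddOrder (m i j)
  twist-> i j j<i refl | tri> _ _ _ | just h = refl
  ... | tri≈ _ _ j≮i | just h = contradiction j<i j≮i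
  ... | tri< _ _ j≮i | just h = contradiction j<i j≮i

  pairOrder-< : ∀ i j → i Fin.< j → pairOrder i j ≡ oddOrder (m i j)
  pairOrder-< i j i<j with <-cmp i j
  ... | tri< _ _ _   = refl
  ... | tri≈ i≮j _ _ = contradiction i<j i≮j
  ... | tri> i≮j _ _ = contradiction i<j i≮j

  order-< : ∀ i j {h} → i Fin.< j → oddOrder (m i j) ≡ just h → order (combine i j) ≡ just h
  order-< i j i<j eq =
    trans (cong (uncurry pairOrder) (remQuot-combine i j)) (trans (pairOrder-< i j i<j) eq)

  twisted : ∀ i j h → i ≢ j → oddOrder (m i j) ≡ just h → Twisted h i j
  twisted i j h i≢j eq with <-cmp i j
  ... | tri≈ _ i≡j _ = contradiction i≡j i≢j
  ... | tri< i<j _ _ = record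
    { has-order = order-< i j i<j eq
    ; twist₁ = twist-< i j i<j eq ; twist₂ = twist-> j i i<j eq′
    ; unit₁ = inj₁ refl ; unit₂ = inj₂ refl ; total = refl }
    where eq′ = trans (cong oddOrder (m-sym j i)) eq
  ... | tri> _ _ j<i = record
    { has-order = order-< j i j<i eq′
    ; twist₁ = twist-> i j j<i eq ; twist₂ = twist-< j i j<i eq′
    ; unit₁ = inj₂ refl ; unit₂ = inj₁ refl ; total = +-comm (2 + (h + h)) 1 }
    where eq′ = trans (cong oddOrder (m-sym j i)) eq

  -- The firing action and its invariance under the defining relations.

  Node : Set
  Node = Maybe (Fin k)

  State : Set
  State = Node → Index → Bool

  -- The extra node `nothing` receives coefficient 1, the node of `t` receives 1 + Z_st.
  coef : Fin k → Node → (Index → Bool) → Index → Bool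
  coef s nothing  x a = x a
  coef s (just t) x a = x a xor x (σ s t a)

  fire : Fin k → State → State
  fire s f t a = f t a xor coef s t (f (just s)) a

  act : Word → State → State
  act []      f = f
  act (s ∷ u) f = fire s (act u f)

  AllBalanced : State → Set
  AllBalanced f = ∀ t → IsBalanced (f t)

  coef-balanced : ∀ s t {x} → IsBalanced x → IsBalanced (coef s t x)
  coef-balanced s nothing  bx = bx
  coef-balanced s (just t) bx = xor-balanced bx (shift-balanced _ _ bx)

  fire-balanced : ∀ s {f} → AllBalanced f → AllBalanced (fire s f)
  fire-balanced s bf t = xor-balanced (bf t) (coef-balanced s t (bf (just s)))

  act-balanced : ∀ u {f} → AllBalanced f → AllBalanced (act u f)
  act-balanced []      bf = bf
  act-balanced (s ∷ u) bf = fire-balanced s (act-balanced u bf)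

  infix 4 _≐_
  _≐_ : State → State → Set
  f ≐ g = ∀ t a → f t a ≡ g t a

  coef-cong : ∀ s t {x y : Index → Bool} → (∀ a → x a ≡ y a) → ∀ a → coef s t x a ≡ coef s t y a
  coef-cong s nothing  eq a = eq a
  coef-cong s (just t) eq a = cong₂ _xor_ (eq a) (eq _)

  act-cong : ∀ u {f g} → f ≐ g → act u f ≐ act u g
  act-cong []      eq     = eq
  act-cong (s ∷ u) eq t a = cong₂ _xor_ (act-cong u eq t a) (coef-cong s t (act-cong u eq (just s)) a)

  act-++ : ∀ u v f → act (u ++ v) f ≡ act u (act v f)
  act-++ []      v f = refl
  act-++ (s ∷ u) v f = cong (fire s) (act-++ u v f)

  coef-untwisted : ∀ s t → proj₂ (twist s t) ≡ 0 → ∀ (x : Index → Bool) a → coef s (just t) x a ≡ false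
  coef-untwisted s t eq x a = trans (cong (λ b → x a xor x b) (untwisted s t eq a)) (xor-same (x a))

  -- The first firing does not change node `s`, so the second adds the same amounts again and they
  -- cancel.
  fire-fire : ∀ s f → fire s (fire s f) ≐ f
  fire-fire s f t a = trans
    (cong (fire s f t a xor_) (coef-cong s t
      (λ b → trans (cong (f (just s) b xor_) (coef-untwisted s s (twist-diagonal s) (f (just s)) b))
                   (xor-identityʳ _)) a))
    (solve 2 (λ x y → (x :+ y) :+ y := x) refl (f t a) (coef s t (f (just s)) a))

  coef-⨁ : ∀ s t n (x : ℕ → Index → Bool) → (∀ a → ⨁ n (λ c → x c a) ≡ false) →
           ∀ a → ⨁ n (λ c → coef s t (x c) a) ≡ false
  coef-⨁ s nothing  n x eq a = eq a
  coef-⨁ s (just t) n x eq a = trans (⨁-xor n _ _) (cong₂ _xor_ (eq a) (eq _))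

  module _ (i j : Fin k) (f : State) where

    private
      power : ℕ → State
      power c = act (concat (replicate c (i ∷ j ∷ []))) f

      -- j is fired before i, since words act from the left
      x y : ℕ → Index → Bool
      x c = power c (just j)
      y c = fire j (power c) (just i)

    -- Every round adds to node `t` a linear image of the values fired at `j` and at `i`. By
    -- linearity only the totals of the fired values over all rounds matter.
    power-closed : ∀ n t a → power n t a ≡
      f t a xor ⨁ n (λ c → coef j t (x c) a xor coef i t (y c) a)
    power-closed zero    t a = sym (xor-identityʳ _)
    power-closed (suc n) t a = trans
      (cong (λ z → (z xor coef j t (x n) a) xor coef i t (y n) a) (power-closed n t a))
      (solve 4 (λ p q r s → ((p :+ q) :+ r) :+ s := p :+ (q :+ (r :+ s))) refl
        (f t a) (⨁ n (λ c → coef j t (x c) a xor coef i t (y c) a)) (coef j t (x n) a) (coef i t (y n) a))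

    power-trivial : ∀ n → (∀ a → ⨁ n (λ c → x c a) ≡ false) → (∀ a → ⨁ n (λ c → y c a) ≡ false) →
                    power n ≐ f
    power-trivial n X≡0 Y≡0 t a = begin
      power n t a
        ≡⟨ power-closed n t a ⟩
      f t a xor ⨁ n (λ c → coef j t (x c) a xor coef i t (y c) a)
        ≡⟨ cong (f t a xor_) (trans (⨁-xor n _ _)
             (cong₂ _xor_ (coef-⨁ j t n x X≡0 a) (coef-⨁ i t n y Y≡0 a))) ⟩
      f t a xor false
        ≡⟨ xor-identityʳ _ ⟩
      f t a ∎
      where open ≡-Reasoning

    -- With identity twists, nodes `i` and `j` never change, so each fires one constant value an
    -- even number of times.
    even-power : ∀ h → proj₂ (twist i j) ≡ 0 → proj₂ (twist j i) ≡ 0 → power (h + h) ≐ f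
    even-power h ij≡0 ji≡0 = power-trivial (h + h)
      (λ a → trans (⨁-cong (h + h) (λ c → x-const c a)) (⨁-const-even h _))
      (λ a → trans (⨁-cong (h + h) (λ c → y-const c a)) (⨁-const-even h _))
      where
      x-const : ∀ c a → x c a ≡ f (just j) a
      x-const zero    a = refl
      x-const (suc c) a = trans
        (cong₂ _xor_ (cong (x c a xor_) (coef-untwisted j j (twist-diagonal j) (x c) a))
                     (coef-untwisted i j ij≡0 (y c) a))
        (trans (xor-identityʳ _) (trans (xor-identityʳ _) (x-const c a)))

      power-i : ∀ c a → power c (just i) a ≡ f (just i) a
      y-const : ∀ c a → y c a ≡ f (just i) a
      power-i zero    a = refl
      power-i (suc c) a = trans (cong (y c a xor_) (coef-untwisted i i (twist-diagonal i) (y c) a))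
        (trans (xor-identityʳ _) (y-const c a))
      y-const c a = trans (cong (power c (just i) a xor_) (coef-untwisted j i ji≡0 (x c) a))
        (trans (xor-identityʳ _) (power-i c a))

    -- With Z = Z_ji, a round maps u = x + y to Z⁻¹u and v = Zx + y to Zv, so all sums
    -- over n rounds are geometric; they give (1 + Z) ∑ x = ∑ (u + v) = 0, hence ∑ x = 0.
    odd-power : ∀ h → Twisted h j i → AllBalanced f → power (odd h) ≐ f
    odd-power h tw bf = power-trivial n X≡0 Y≡0
      where
      open Twisted tw renaming (coordinate to p; amount₁ to r; amount₂ to r′)
      open ≡-Reasoning
      n = odd h

      Z Z⁻¹ : Index → Index
      Z   = shift p r
      Z⁻¹ = shift p r′

      x-balanced : ∀ c → IsBalanced (x c)
      x-balanced c = act-balanced (concat (replicate c (i ∷ j ∷ []))) bf (just j)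

      cancel : ∀ {g} → IsBalanced g → ∀ a → g (Z (Z⁻¹ a)) ≡ g a
      cancel {g} bg a = trans (cong g (trans (shift-shift p r r′ a) (cong (λ z → shift p z a) total)))
        (shift-period has-order bg a)

      cancel′ : ∀ {g} → IsBalanced g → ∀ a → g (Z⁻¹ (Z a)) ≡ g a
      cancel′ {g} bg a = trans (cong g (shift-comm p p r′ r a)) (cancel bg a)

      w u v : ℕ → Index → Bool
      w c = power c (just i)
      u c a = x c a xor w c a
      v c a = x c (Z a) xor w c a

      y-eq : ∀ c a → y c a ≡ w c a xor (x c a xor x c (Z a))
      y-eq c a = cong (λ q → w c a xor (x c a xor x c (uncurry shift q a))) twist₁

      y≡v+x : ∀ c a → y c a ≡ v c a xor x c a
      y≡v+x c a = trans (y-eq c a)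
        (solve 3 (λ w x z → w :+ (x :+ z) := (z :+ w) :+ x) refl (w c a) (x c a) (x c (Z a)))

      y-balanced : ∀ c → IsBalanced (y c)
      y-balanced c = fire-balanced j (act-balanced (concat (replicate c (i ∷ j ∷ []))) bf) (just i)

      x-suc : ∀ c a → x (suc c) a ≡ x c a xor (y c a xor y c (Z⁻¹ a))
      x-suc c a = cong₂ _xor_
        (trans (cong (x c a xor_) (coef-untwisted j j (twist-diagonal j) (x c) a)) (xor-identityʳ (x c a)))
        (cong (λ q → y c a xor y c (uncurry shift q a)) twist₂)

      w-suc : ∀ c a → w (suc c) a ≡ y c a
      w-suc c a = trans (cong (y c a xor_) (coef-untwisted i i (twist-diagonal i) (y c) a)) (xor-identityʳ _)

      u-suc : ∀ c a → u (suc c) a ≡ u c (Z⁻¹ a)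
      u-suc c a = begin
        x (suc c) a xor w (suc c) a
          ≡⟨ cong₂ _xor_ (x-suc c a) (w-suc c a) ⟩
        (x c a xor (y c a xor y c (Z⁻¹ a))) xor y c a
          ≡⟨ solve 3 (λ x y z → (x :+ (y :+ z)) :+ y := x :+ z) refl (x c a) (y c a) (y c (Z⁻¹ a)) ⟩
        x c a xor y c (Z⁻¹ a)
          ≡⟨ cong (x c a xor_) (y-eq c (Z⁻¹ a)) ⟩
        x c a xor (w c (Z⁻¹ a) xor (x c (Z⁻¹ a) xor x c (Z (Z⁻¹ a))))
          ≡⟨ cong (λ z → x c a xor (w c (Z⁻¹ a) xor (x c (Z⁻¹ a) xor z))) (cancel (x-balanced c) a) ⟩
        x c a xor (w c (Z⁻¹ a) xor (x c (Z⁻¹ a) xor x c a))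
          ≡⟨ solve 3 (λ x w z → x :+ (w :+ (z :+ x)) := z :+ w) refl (x c a) (w c (Z⁻¹ a)) (x c (Z⁻¹ a)) ⟩
        u c (Z⁻¹ a) ∎

      v-suc : ∀ c a → v (suc c) a ≡ v c (Z a)
      v-suc c a = begin
        x (suc c) (Z a) xor w (suc c) a
          ≡⟨ cong₂ _xor_ (x-suc c (Z a)) (w-suc c a) ⟩
        (x c (Z a) xor (y c (Z a) xor y c (Z⁻¹ (Z a)))) xor y c a
          ≡⟨ cong (λ z → (x c (Z a) xor (y c (Z a) xor z)) xor y c a) (cancel′ (y-balanced c) a) ⟩
        (x c (Z a) xor (y c (Z a) xor y c a)) xor y c a
          ≡⟨ cong (λ z → (x c (Z a) xor (z xor y c a)) xor y c a) (y≡v+x c (Z a)) ⟩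
        (x c (Z a) xor ((v c (Z a) xor x c (Z a)) xor y c a)) xor y c a
          ≡⟨ solve 3 (λ x v y → (x :+ ((v :+ x) :+ y)) :+ y := v) refl (x c (Z a)) (v c (Z a)) (y c a) ⟩
        v c (Z a) ∎

      u-closed : ∀ c a → u c a ≡ u 0 (shift p (c * r′) a)
      u-closed zero    a = cong (u 0) (sym (shift-0 p a))
      u-closed (suc c) a = trans (u-suc c a)
        (trans (u-closed c (Z⁻¹ a)) (cong (u 0) (shift-suc p r′ c a)))

      v-closed : ∀ c a → v c a ≡ v 0 (shift p (c * r) a)
      v-closed zero    a = cong (v 0) (sym (shift-0 p a))
      v-closed (suc c) a = trans (v-suc c a)
        (trans (v-closed c (Z a)) (cong (v 0) (shift-suc p r c a)))

      ∑u≡0 : ∀ a → ⨁ n (λ c → u c a) ≡ false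
      ∑u≡0 a = trans (⨁-cong n (λ c → u-closed c a))
        (geometric-sum has-order unit₂ (xor-balanced (bf (just j)) (bf (just i))) a)

      ∑v≡0 : ∀ a → ⨁ n (λ c → v c a) ≡ false
      ∑v≡0 a = trans (⨁-cong n (λ c → v-closed c a))
        (geometric-sum has-order unit₁ (xor-balanced (shift-balanced p r (bf (just j))) (bf (just i))) a)

      X≡0 : ∀ a → ⨁ n (λ c → x c a) ≡ false
      X≡0 = fixed⇒false has-order unit₁ (⨁-balanced n x x-balanced) λ a →
        xor≡false⇒≡ (begin
          ⨁ n (λ c → x c (Z a)) xor ⨁ n (λ c → x c a)
            ≡⟨ ⨁-xor n _ _ ⟨
          ⨁ n (λ c → x c (Z a) xor x c a)
            ≡⟨ ⨁-cong n (λ c → solve 3 (λ x w z → z :+ x := (x :+ w) :+ (z :+ w)) refl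
                                   (x c a) (w c a) (x c (Z a))) ⟩
          ⨁ n (λ c → u c a xor v c a)
            ≡⟨ trans (⨁-xor n _ _) (cong₂ _xor_ (∑u≡0 a) (∑v≡0 a)) ⟩
          false ∎)

      Y≡0 : ∀ a → ⨁ n (λ c → y c a) ≡ false
      Y≡0 a = trans (⨁-cong n (λ c → y≡v+x c a))
        (trans (⨁-xor n _ _) (cong₂ _xor_ (∑v≡0 a) (X≡0 a)))

  relator-trivial : ∀ {u} → Relator u → ∀ f → AllBalanced f → act u f ≐ f
  relator-trivial (sq i) f bf = fire-fire i f
  relator-trivial (braid i j n i≢j eq) f bf with oddOrder-cases n n≢1
    where
    n≢1 : n ≢ 1
    n≢1 refl with m-≥2 i j i≢j 1 eq
    ... | s≤s ()
  ... | inj₁ (h , refl , even) = even-power i j f h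
    (twist-even i j (trans (cong oddOrder eq) even))
    (twist-even j i (trans (cong oddOrder (trans (m-sym j i) eq)) even))
  ... | inj₂ (h , refl , is-odd) = odd-power i j f h
    (twisted j i h (i≢j ∘ sym) (trans (cong oddOrder (trans (m-sym j i) eq)) is-odd)) bf

  act-≈ : ∀ {u v} → u ≈W v → ∀ f → AllBalanced f → act u f ≐ act v f
  act-≈ (rel u r v rr) f bf t a = begin
    act (u ++ r ++ v) f t a        ≡⟨ cong (λ g → g t a) (trans (act-++ u (r ++ v) f) (cong (act u) (act-++ r v f))) ⟩
    act u (act r (act v f)) t a    ≡⟨ act-cong u (relator-trivial rr (act v f) (act-balanced v bf)) t a ⟩
    act u (act v f) t a            ≡⟨ cong (λ g → g t a) (act-++ u v f) ⟨
    act (u ++ v) f t a             ∎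
    where open ≡-Reasoning
  act-≈ ≈refl         f bf t a = refl
  act-≈ (≈sym eq)     f bf t a = sym (act-≈ eq f bf t a)
  act-≈ (≈trans e e′) f bf t a = trans (act-≈ e f bf t a) (act-≈ e′ f bf t a)

  -- The test state is `weight` at node `i` and zero elsewhere. At the origin, firing `i` adds 1 to
  -- the extra node, while firing a different `j` adds 0.
  generators-distinct : ∀ i j → (i ∷ []) ≈W (j ∷ []) → i ≡ j
  generators-distinct i j eq with i ≟ j
  ... | yes i≡j = i≡j
  ... | no  i≢j = contradiction true≡false λ ()
    where
    W : Index → Bool
    W = weight (k * k) order

    f : State
    f nothing  = λ _ → false
    f (just t) with i ≟ t
    ... | yes _ = W
    ... | no  _ = λ _ → false

    bf : AllBalanced f
    bf nothing = false-balanced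
    bf (just t) with i ≟ t
    ... | yes _ = weight-balanced (k * k) order
    ... | no  _ = false-balanced

    o : Index
    o = Vec.replicate (k * k) 0

    f-i : f (just i) o ≡ true
    f-i with i ≟ i
    ... | yes _  = weight-0 (k * k) order
    ... | no i≢i = contradiction refl i≢i

    f-j : f (just j) o ≡ false
    f-j with i ≟ j
    ... | yes i≡j = contradiction i≡j i≢j
    ... | no _    = refl

    true≡false : true ≡ false
    true≡false = trans (sym f-i) (trans (act-≈ eq f bf nothing o) f-j)

-- Group laws of W on words.

module WordGroup {k : ℕ} (M : CoxeterMatrix k) where
  open CoxeterMatrix M
  open Coxeter M
  open CharacteristicTwo using (⨁; ⨁-cong; ⨁-+)
  open ≡
  open xor-∧-Solver using (solve; _:+_; _:=_)

  ≈-reflexive : ∀ {u v} → u ≡ v → u ≈W v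
  ≈-reflexive refl = ≈refl

  ++-congˡ : ∀ u {v w} → v ≈W w → (u ++ v) ≈W (u ++ w)
  ++-congˡ u (rel x r y rr) = ≈trans (≈-reflexive (sym (++-assoc u x (r ++ y))))
    (≈trans (rel (u ++ x) r y rr) (≈-reflexive (++-assoc u x y)))
  ++-congˡ u ≈refl        = ≈refl
  ++-congˡ u (≈sym e)     = ≈sym (++-congˡ u e)
  ++-congˡ u (≈trans e d) = ≈trans (++-congˡ u e) (++-congˡ u d)

  ++-congʳ : ∀ {v w} u → v ≈W w → (v ++ u) ≈W (w ++ u)
  ++-congʳ u (rel x r y rr) = ≈trans
    (≈-reflexive (trans (++-assoc x (r ++ y) u) (cong (x ++_) (++-assoc r y u))))
    (≈trans (rel x r (y ++ u) rr) (≈-reflexive (sym (++-assoc x y u))))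
  ++-congʳ u ≈refl        = ≈refl
  ++-congʳ u (≈sym e)     = ≈sym (++-congʳ u e)
  ++-congʳ u (≈trans e d) = ≈trans (++-congʳ u e) (++-congʳ u d)

  ∷-cong : ∀ s {u v} → u ≈W v → (s ∷ u) ≈W (s ∷ v)
  ∷-cong s = ++-congˡ (s ∷ [])

  ∷∷-cancel : ∀ s u → (s ∷ s ∷ u) ≈W u
  ∷∷-cancel s u = rel [] (s ∷ s ∷ []) u (sq s)

  ∷-move : ∀ {s u v} → (s ∷ u) ≈W v → u ≈W (s ∷ v)
  ∷-move {s} {u} e = ≈trans (≈sym (∷∷-cancel s u)) (∷-cong s e)

  ++-cancelˡ : ∀ u {v w} → (u ++ v) ≈W (u ++ w) → v ≈W w
  ++-cancelˡ []      e = e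
  ++-cancelˡ (s ∷ u) e = ++-cancelˡ u (≈trans (∷-move e) (∷∷-cancel s _))

  snoc-cancel : ∀ u s → ((u ++ s ∷ []) ++ s ∷ []) ≈W u
  snoc-cancel u s = ≈trans (≈-reflexive (++-assoc u (s ∷ []) (s ∷ [])))
    (≈trans (rel u (s ∷ s ∷ []) [] (sq s)) (≈-reflexive (++-identityʳ u)))

  ++-cancelʳ : ∀ u {v w} → (v ++ u) ≈W (w ++ u) → v ≈W w
  ++-cancelʳ []      e = ≈trans (≈-reflexive (sym (++-identityʳ _))) (≈trans e (≈-reflexive (++-identityʳ _)))
  ++-cancelʳ (s ∷ u) {v} {w} e = ≈trans (≈sym (snoc-cancel v s)) (≈trans (++-congʳ (s ∷ [])
    (++-cancelʳ u (≈trans (≈-reflexive (++-assoc v (s ∷ []) u)) (≈trans e (≈-reflexive (sym (++-assoc w (s ∷ []) u)))))))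
    (snoc-cancel w s))

  -- The reflection parity and the exchange property.

  module Cocycle (dec : ∀ u v → Dec (u ≈W v)) where

    [_≈_] : Word → Word → Bool
    [ u ≈ v ] = does (dec u v)

    [≈]-⇔ : ∀ {u v u′ v′} → (u ≈W v → u′ ≈W v′) → (u′ ≈W v′ → u ≈W v) → [ u ≈ v ] ≡ [ u′ ≈ v′ ]
    [≈]-⇔ to from = does-⇔ (mk⇔ to from) (dec _ _) (dec _ _)

    [≈]-cong : ∀ {u v u′ v′} → u ≈W u′ → v ≈W v′ → [ u ≈ v ] ≡ [ u′ ≈ v′ ]
    [≈]-cong e d = [≈]-⇔ (λ p → ≈trans (≈sym e) (≈trans p d)) (λ p → ≈trans e (≈trans p (≈sym d)))

    -- For w = s₁⋯s_q, the parity of the number of c with s_q⋯s_c⋯s_q ≈ r.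
    ρ : Word → Word → Bool
    ρ []      r = false
    ρ (t ∷ w) r = [ t ∷ w ≈ w ++ r ] xor ρ w r

    ρ-congˡ : ∀ u {v w} r → v ≈W w → ρ v r ≡ ρ w r → ρ (u ++ v) r ≡ ρ (u ++ w) r
    ρ-congˡ []      r e eq = eq
    ρ-congˡ (t ∷ u) r e eq = cong₂ _xor_
      ([≈]-cong (++-congˡ (t ∷ u) e) (++-congʳ r (++-congˡ u e))) (ρ-congˡ u r e eq)

    -- The two letters contribute equal terms, since iiv = ivr holds exactly when iv = vr.
    ρ-sq : ∀ i v r → ρ (i ∷ i ∷ v) r ≡ ρ v r
    ρ-sq i v r = trans
      (cong (_xor (b xor ρ v r)) ([≈]-⇔ {u′ = i ∷ v} {v′ = v ++ r}
        (λ e → ≈trans (∷-move e) (∷∷-cancel i _)) (∷-cong i)))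
      (trans (sym (xor-assoc b b _)) (cong (_xor ρ v r) (xor-same b)))
      where b = [ i ∷ v ≈ v ++ r ]

    module _ (i j : Fin k) where

      g : ℕ → Word
      g n = concat (replicate n (i ∷ j ∷ []))

      g-+ : ∀ a b → g (a ℕ.+ b) ≡ g a ++ g b
      g-+ zero    b = refl
      g-+ (suc a) b = cong (λ w → i ∷ j ∷ w) (g-+ a b)

      g-comm : ∀ a b → g a ++ g b ≡ g b ++ g a
      g-comm a b = trans (sym (g-+ a b)) (trans (cong g (ℕ.+-comm a b)) (g-+ b a))

      -- With g = ij one has g j g = j, that is, conjugation by `j` inverts g.
      inverted : ∀ a w → (g a ++ j ∷ g a ++ w) ≈W (j ∷ w)
      inverted zero    w = ≈refl
      inverted (suc a) w = ≈trans (≈-reflexive (trans (cong (_++ (j ∷ g (suc a) ++ w)) (g-comm 1 a))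
          (++-assoc (g a) (g 1) _)))
        (≈trans (++-congˡ (g a) (≈trans (∷-cong i (∷∷-cancel j _)) (∷∷-cancel i _))) (inverted a w))

      -- The letters j and i preceding gᵃv contribute [v r v⁻¹ = j g²ᵃ] and [v r v⁻¹ = j g²ᵃ⁺¹],
      -- since j g j = g⁻¹; both are terms of one sequence with period n when gⁿ = 1.
      E : Word → Word → ℕ → Bool
      E v r c = [ j ∷ g c ++ v ≈ v ++ r ]

      -- Multiplying j g²ᵃ v = v r on the left by gᵃ gives j gᵃ v = gᵃ v r, because gᵃ j gᵃ = j. The
      -- odd case multiplies by j gᵃ instead.
      E-even : ∀ v r a → [ j ∷ g a ++ v ≈ (g a ++ v) ++ r ] ≡ E v r (a ℕ.+ a)
      E-even v r a = sym ([≈]-⇔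
        (λ e → ≈trans (≈sym conj) (≈trans (++-congˡ (g a) e) (≈-reflexive (sym (++-assoc (g a) v r)))))
        (λ e → ++-cancelˡ (g a) (≈trans conj (≈trans e (≈-reflexive (++-assoc (g a) v r))))))
        where
        conj : (g a ++ j ∷ g (a ℕ.+ a) ++ v) ≈W (j ∷ g a ++ v)
        conj = ≈trans (≈-reflexive (cong (λ w → g a ++ j ∷ w)
            (trans (cong (_++ v) (g-+ a a)) (++-assoc (g a) (g a) v)))) (inverted a (g a ++ v))

      E-odd : ∀ v r a → [ i ∷ j ∷ g a ++ v ≈ (j ∷ g a ++ v) ++ r ] ≡ E v r (suc (a ℕ.+ a))
      E-odd v r a = sym ([≈]-⇔
        (λ e → ≈trans (≈sym conj) (≈trans (++-congˡ (j ∷ g a) e) (≈-reflexive (sym (++-assoc (j ∷ g a) v r)))))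
        (λ e → ++-cancelˡ (j ∷ g a) (≈trans conj (≈trans e (≈-reflexive (++-assoc (j ∷ g a) v r))))))
        where
        conj : ((j ∷ g a) ++ j ∷ g (suc (a ℕ.+ a)) ++ v) ≈W (g (suc a) ++ v)
        conj = ≈trans (≈-reflexive (cong (λ w → (j ∷ g a) ++ j ∷ w)
            (trans (cong (λ n → g n ++ v) (sym (ℕ.+-suc a a)))
              (trans (cong (_++ v) (g-+ a (suc a))) (++-assoc (g a) (g (suc a)) v)))))
          (≈trans (∷-cong j (inverted a (g (suc a) ++ v))) (∷∷-cancel j _))

      ρ-power : ∀ v r n → ρ (g n ++ v) r ≡ ⨁ (n ℕ.+ n) (E v r) xor ρ v r
      ρ-power v r zero    = refl
      ρ-power v r (suc n) = begin
        [ i ∷ j ∷ z ≈ j ∷ z ++ r ] xor ([ j ∷ z ≈ z ++ r ] xor ρ z r)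
          ≡⟨ cong₂ _xor_ (E-odd v r n) (cong₂ _xor_ (E-even v r n) (ρ-power v r n)) ⟩
        E v r (suc (n ℕ.+ n)) xor (E v r (n ℕ.+ n) xor (⨁ (n ℕ.+ n) (E v r) xor ρ v r))
          ≡⟨ solve 4 (λ a b c d → a :+ (b :+ (c :+ d)) := ((c :+ b) :+ a) :+ d) refl
               (E v r (suc (n ℕ.+ n))) (E v r (n ℕ.+ n)) (⨁ (n ℕ.+ n) (E v r)) (ρ v r) ⟩
        ⨁ (2 ℕ.+ (n ℕ.+ n)) (E v r) xor ρ v r
          ≡⟨ cong (λ c → ⨁ (suc c) (E v r) xor ρ v r) (ℕ.+-suc n n) ⟨
        ⨁ (suc n ℕ.+ suc n) (E v r) xor ρ v r ∎
        where
        open ≡-Reasoning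
        z = g n ++ v

      -- The 2n letters contribute 2n consecutive terms of a sequence of period n, so the two halves
      -- cancel.
      ρ-braid : ∀ n → (∀ w → (g n ++ w) ≈W w) → ∀ v r → ρ (g n ++ v) r ≡ ρ v r
      ρ-braid n trivial v r = trans (ρ-power v r n) (cong (_xor ρ v r) (begin
        ⨁ (n ℕ.+ n) (E v r)                              ≡⟨ ⨁-+ n n (E v r) ⟩
        ⨁ n (E v r) xor ⨁ n (λ c → E v r (c ℕ.+ n))      ≡⟨ cong (⨁ n (E v r) xor_) (⨁-cong n periodic) ⟩
        ⨁ n (E v r) xor ⨁ n (E v r)                      ≡⟨ xor-same (⨁ n (E v r)) ⟩
        false                                            ∎))
        where
        open ≡-Reasoning
        periodic : ∀ c → E v r (c ℕ.+ n) ≡ E v r c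
        periodic c = [≈]-cong (∷-cong j (≈trans
          (≈-reflexive (trans (cong (_++ v) (g-+ c n)) (++-assoc (g c) (g n) v)))
          (++-congˡ (g c) (trivial v)))) ≈refl

    ρ-relator : ∀ {u} → Relator u → ∀ v r → ρ (u ++ v) r ≡ ρ v r
    ρ-relator (sq i)             v r = ρ-sq i v r
    ρ-relator (braid i j n ne e) v r = ρ-braid i j n (λ w → rel [] _ w (braid i j n ne e)) v r

    ρ-cong : ∀ {u v} → u ≈W v → ∀ r → ρ u r ≡ ρ v r
    ρ-cong (rel u x v rr) r = ρ-congˡ u r (rel [] x v rr) (ρ-relator rr v r)
    ρ-cong ≈refl        r = refl
    ρ-cong (≈sym e)     r = sym (ρ-cong e r)
    ρ-cong (≈trans e d) r = trans (ρ-cong e r) (ρ-cong d r)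

    ρ-generator : ∀ {u s} → u ≈W (s ∷ []) → ρ u (s ∷ []) ≡ true
    ρ-generator {u} {s} e = trans (ρ-cong e (s ∷ []))
      (cong (_xor false) (dec-true (dec (s ∷ []) (s ∷ [])) ≈refl))

    -- Odd parity makes some term true, say tw = wr for a suffix tw; then twr = w, which deletes the
    -- letter t.
    ρ⇒shorter : ∀ w r → ρ w r ≡ true → ∃[ v ] (w ++ r) ≈W v × length v ℕ.< length w
    ρ⇒shorter (t ∷ w) r eq with dec (t ∷ w) (w ++ r)
    ... | yes e = w , ≈sym (∷-move e) , ℕ.≤-refl
    ... | no _  with ρ⇒shorter w r eq
    ...   | v , e , lt = t ∷ v , ∷-cong t e , ℕ.s≤s lt

    -- Otherwise us has a word shorter than `u`, and putting it in place of us shortens the whole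
    -- reduced word.
    reduced⇒ascent : ∀ u s v → Reduced (u ++ s ∷ v) → ρ u (s ∷ []) ≡ false
    reduced⇒ascent u s v red = ¬-not λ down → descent (ρ⇒shorter u (s ∷ []) down)
      where
      descent : ¬ (∃[ y ] (u ++ s ∷ []) ≈W y × length y ℕ.< length u)
      descent (y , us≈y , y<u) = ℕ.<⇒≱ shorter (red (y ++ v)
        (≈trans (++-congʳ v (≈sym us≈y)) (≈-reflexive (++-assoc u (s ∷ []) v))))
        where
        shorter : length (y ++ v) ℕ.< length (u ++ s ∷ v)
        shorter = subst₂ ℕ._<_ (sym (length-++ y)) (sym (length-++ u))
          (ℕ.+-mono-<-≤ y<u (ℕ.n≤1+n (length v)))

-- Inequalities in an ordered field.

module OrderedFieldProperties {c ℓ : Level} (F : OrderedField c ℓ) where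
  open OrderedField F
  open IsTotalOrder ≤F-isTotalOrder public
    using () renaming (refl to ≤-refl; trans to ≤-trans; reflexive to ≤-reflexive; total to ≤-total)
  open SemiringSolver commutativeSemiring using (solve; _:+_; _:*_; _:=_)

  +-mono : ∀ {a b c d} → a ≤F b → c ≤F d → (a + c) ≤F (b + d)
  +-mono {b = b} {c} a≤b c≤d = ≤-trans (≤F-+-mono c a≤b) (≤-trans (≤-reflexive (+-comm b c))
    (≤-trans (≤F-+-mono b c≤d) (≤-reflexive (+-comm _ b))))

  ≤⇒difference : ∀ {a b} → a ≤F b → ∃[ d ] (0# ≤F d × a + d ≈ b)
  ≤⇒difference {a} {b} a≤b = b + - a , ≤-trans (≤-reflexive (sym (-‿inverseʳ a))) (≤F-+-mono (- a) a≤b) ,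
    trans (+-comm a _) (trans (+-assoc b (- a) a) (trans (+-congˡ (-‿inverseˡ a)) (+-identityʳ b)))

  difference⇒≤ : ∀ {a b d} → 0# ≤F d → a + d ≈ b → a ≤F b
  difference⇒≤ {a} 0≤d eq = ≤-trans (≤-reflexive (sym (+-identityʳ a)))
    (≤-trans (+-mono ≤-refl 0≤d) (≤-reflexive eq))

  *-monoˡ : ∀ {a b c} → 0# ≤F c → a ≤F b → (c * a) ≤F (c * b)
  *-monoˡ {a} {c = c} 0≤c a≤b with ≤⇒difference a≤b
  ... | d , 0≤d , eq = difference⇒≤ (≤F-*-nonneg 0≤c 0≤d) (trans (sym (distribˡ c a d)) (*-congˡ eq))

  -- The two sides differ by (r - q)(a - b).
  rearrangement : ∀ {q r a b} → q ≤F r → b ≤F a → (r * b + q * a) ≤F (r * a + q * b)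
  rearrangement {q} {r} {a} {b} q≤r b≤a with ≤⇒difference q≤r | ≤⇒difference b≤a
  ... | d , 0≤d , q+d≈r | e , 0≤e , b+e≈a = difference⇒≤ (≤F-*-nonneg 0≤d 0≤e) (begin
    (r * b + q * a) + d * e
      ≈⟨ +-congʳ (+-cong (*-congʳ (sym q+d≈r)) (*-congˡ (sym b+e≈a))) ⟩
    ((q + d) * b + q * (b + e)) + d * e
      ≈⟨ solve 4 (λ q d b e → ((q :+ d) :* b :+ q :* (b :+ e)) :+ d :* e
                           := (q :+ d) :* (b :+ e) :+ q :* b) refl q d b e ⟩
    (q + d) * (b + e) + q * b
      ≈⟨ +-congʳ (*-cong q+d≈r b+e≈a) ⟩
    r * a + q * b ∎)
    where open import Relation.Binary.Reasoning.Setoid setoid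

  0≤1 : 0# ≤F 1#
  0≤1 with ≤-total 0# 1#
  ... | inj₁ 0≤1 = 0≤1
  ... | inj₂ 1≤0 with ≤⇒difference 1≤0
  -- Here d = -1 is nonnegative, and 1 = d * d.
  ...   | d , 0≤d , 1+d≈0 = difference⇒≤ (≤F-*-nonneg 0≤d 0≤d) (begin
    0# + d * d             ≈⟨ +-congʳ (sym 1+d≈0) ⟩
    (1# + d) + d * d       ≈⟨ +-assoc 1# d (d * d) ⟩
    1# + (d + d * d)       ≈⟨ +-congˡ (+-congʳ (sym (*-identityˡ d))) ⟩
    1# + (1# * d + d * d)  ≈⟨ +-congˡ (sym (distribʳ d 1# d)) ⟩
    1# + (1# + d) * d      ≈⟨ +-congˡ (trans (*-congʳ 1+d≈0) (zeroˡ d)) ⟩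
    1# + 0#                ≈⟨ +-identityʳ 1# ⟩
    1#                     ∎)
    where open import Relation.Binary.Reasoning.Setoid setoid

-- The first-step recursion for the walk.

module WalkProperties {c ℓ : Level} (F : OrderedField c ℓ) {k : ℕ} (M : CoxeterMatrix k) where
  open OrderedField F
  open OrderedFieldProperties F
  open Coxeter M
  open Walk F M
  open WordGroup M
  open DistinctGenerators M using (generators-distinct)
  open import Relation.Binary.Reasoning.Setoid setoid
  open SemiringSolver commutativeSemiring using (solve; _:+_; _:*_; _:=_)

  sum-cong : ∀ {A : Set} {f g : A → Carrier} → (∀ x → f x ≈ g x) →
             ∀ xs → sumF (map f xs) ≈ sumF (map g xs)
  sum-cong eq []       = refl
  sum-cong eq (x ∷ xs) = +-cong (eq x) (sum-cong eq xs)

  sum-++ : ∀ xs ys → sumF (xs ++ ys) ≈ sumF xs + sumF ys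
  sum-++ []       ys = sym (+-identityˡ _)
  sum-++ (x ∷ xs) ys = trans (+-congˡ (sum-++ xs ys)) (sym (+-assoc x _ _))

  sum-concat : ∀ {A B : Set} (h : B → Carrier) (G : A → List B) xs →
               sumF (map h (concat (map G xs))) ≈ sumF (map (λ x → sumF (map h (G x))) xs)
  sum-concat h G []       = refl
  sum-concat h G (x ∷ xs) = begin
    sumF (map h (G x ++ concat (map G xs)))
      ≡⟨ ≡.cong sumF (map-++ h (G x) _) ⟩
    sumF (map h (G x) ++ map h (concat (map G xs)))
      ≈⟨ sum-++ (map h (G x)) _ ⟩
    sumF (map h (G x)) + sumF (map h (concat (map G xs)))
      ≈⟨ +-congˡ (sum-concat h G xs) ⟩
    sumF (map (λ x → sumF (map h (G x))) (x ∷ xs)) ∎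

  sum-* : ∀ {A : Set} q (f : A → Carrier) xs → sumF (map (λ x → q * f x) xs) ≈ q * sumF (map f xs)
  sum-* q f []       = sym (zeroʳ q)
  sum-* q f (x ∷ xs) = trans (+-congˡ (sum-* q f xs)) (sym (distribˡ q (f x) _))

  sum-mono : ∀ {A : Set} {f g : A → Carrier} {xs} → All (λ x → f x ≤F g x) xs →
             sumF (map f xs) ≤F sumF (map g xs)
  sum-mono []           = ≤-refl
  sum-mono (f≤g ∷ f≤gs) = +-mono f≤g (sum-mono f≤gs)

  -- A nameable copy of the indicator local to `P`.
  ind : {A : Set} → Dec A → Carrier → Carrier
  ind (yes _) r = r
  ind (no _)  _ = 0#

  ind-cong : ∀ {A B : Set} (d : Dec A) (e : Dec B) r → (A → B) → (B → A) → ind d r ≡ ind e r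
  ind-cong (yes _) (yes _) r to from = ≡.refl
  ind-cong (no _)  (no _)  r to from = ≡.refl
  ind-cong (yes a) (no ¬b) r to from = contradiction (to a) ¬b
  ind-cong (no ¬a) (yes b) r to from = contradiction (from b) ¬a

  ind-* : ∀ {A : Set} (d : Dec A) q r → ind d (q * r) ≈ q * ind d r
  ind-* (yes _) q r = refl
  ind-* (no _)  q r = sym (zeroʳ q)

  module _ (p : Fin k → Carrier) (pid : Carrier) (dec : ∀ u v → Dec (u ≈W v)) where

    open Cocycle dec

    prob : ℕ → Word → Carrier
    prob = P p pid dec

    contribution : ∀ {n} → Word → Vec Step n → Carrier
    contribution x π = ind (dec (pathWord π) x) (pathProb p pid π)

    mutual
      prob-sum : ∀ n x → prob n x ≡ sumF (map (contribution x) (paths n))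
      prob-sum n x = ≡.cong sumF (map-cong (indicator-ind n x) (paths n))

      -- The left side is the summand of `P` with its local indicator, determined by the use in
      -- `prob-sum`.
      indicator-ind : ∀ n x (π : Vec Step n) → _ ≡ contribution x π
      indicator-ind n x π with dec (pathWord π) x
      ... | yes _ = ≡.refl
      ... | no _  = ≡.refl

    prob-cong : ∀ n {x y} → x ≈W y → prob n x ≡ prob n y
    prob-cong n {x} {y} e = ≡.trans (prob-sum n x) (≡.trans
      (≡.cong sumF (map-cong (λ π → ind-cong (dec _ x) (dec _ y) _
        (λ d → ≈trans d e) (λ d → ≈trans d (≈sym e))) (paths n)))
      (≡.sym (prob-sum n y)))

    -- Where the rest of a path must end if the whole path is to end at `x`; after a first step `s`
    -- this is s⁻¹x = sx.
    target : Step → Word → Word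
    target zero    x = x
    target (suc s) x = s ∷ x

    contribution-∷ : ∀ {n} x a (π : Vec Step n) →
      contribution x (a ∷ π) ≈ stepProb p pid a * contribution (target a x) π
    contribution-∷ x zero    π = ind-* (dec (pathWord π) x) pid _
    contribution-∷ x (suc s) π = trans
      (reflexive (ind-cong (dec (s ∷ pathWord π) x) (dec (pathWord π) (s ∷ x)) _
        ∷-move (λ e → ≈trans (∷-cong s e) (∷∷-cancel s x))))
      (ind-* (dec (pathWord π) (s ∷ x)) (p s) _)

    prob-suc : ∀ n x → prob (suc n) x ≈ pid * prob n x + sumF (map (λ s → p s * prob n (s ∷ x)) (allFin k))
    prob-suc n x = begin
      prob (suc n) x
        ≡⟨ prob-sum (suc n) x ⟩
      sumF (map (contribution x) (paths (suc n)))
        ≈⟨ sum-concat (contribution x) (λ a → map (a ∷_) (paths n)) (allFin (suc k)) ⟩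
      sumF (map (λ a → sumF (map (contribution x) (map (a ∷_) (paths n)))) (allFin (suc k)))
        ≈⟨ sum-cong first-step (allFin (suc k)) ⟩
      pid * prob n x + sumF (map summand (tabulate suc))
        ≡⟨ ≡.cong (λ l → pid * prob n x + sumF l)
             (≡.trans (map-tabulate {n = k} suc summand) (≡.sym (map-tabulate {n = k} id (summand ∘ suc)))) ⟩
      pid * prob n x + sumF (map (λ s → p s * prob n (s ∷ x)) (allFin k)) ∎
      where
      summand : Step → Carrier
      summand a = stepProb p pid a * prob n (target a x)

      first-step : ∀ a → sumF (map (contribution x) (map (a ∷_) (paths n))) ≈ summand a
      first-step a = begin
        sumF (map (contribution x) (map (a ∷_) (paths n)))
          ≡⟨ ≡.cong sumF (map-∘ (paths n)) ⟨
        sumF (map (λ π → contribution x (a ∷ π)) (paths n))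
          ≈⟨ sum-cong (contribution-∷ x a) (paths n) ⟩
        sumF (map (λ π → stepProb p pid a * contribution (target a x) π) (paths n))
          ≈⟨ sum-* _ (contribution (target a x)) (paths n) ⟩
        stepProb p pid a * sumF (map (contribution (target a x)) (paths n))
          ≡⟨ ≡.cong (stepProb p pid a *_) (prob-sum n (target a x)) ⟨
        summand a ∎

    -- Monotonicity of the walk along ascents.

    module _ (0≤p : ∀ s → 0# ≤F p s) (0≤pid : 0# ≤F pid) (p≤pid : ∀ s → p s ≤F pid) where

      -- A, B, a t, b t stand for the probabilities of w, ws, tw, tws. Generators are compared
      -- termwise, except that a swapping one is paired with the identity term and handled by
      -- `rearrangement`.
      sum-exchange : ∀ {A B} → B ≤F A → (a b : Fin k → Carrier) (Swap : Fin k → Set) →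
        (∀ t → b t ≤F a t ⊎ Swap t) → (∀ t → Swap t → a t ≈ B × b t ≈ A) →
        (∀ s t → Swap s → Swap t → s ≡ t) → ∀ {ts} → Unique ts →
        (pid * B + sumF (map (λ t → p t * b t) ts)) ≤F (pid * A + sumF (map (λ t → p t * a t) ts))
      sum-exchange B≤A a b Swap cases swap unique [] = +-mono (*-monoˡ 0≤pid B≤A) ≤-refl
      sum-exchange {A} {B} B≤A a b Swap cases swap unique {t ∷ ts} (t∉ts ∷ ts!) with cases t
      -- The identity term is carried past `t`, to stay available for a later swap.
      ... | inj₁ b≤a = ≤-trans (≤-reflexive (insert _ _ _))
        (≤-trans (+-mono (*-monoˡ (0≤p t) b≤a) (sum-exchange B≤A a b Swap cases swap unique ts!))
          (≤-reflexive (sym (insert _ _ _))))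
        where
        insert : ∀ x y z → x + (y + z) ≈ y + (x + z)
        insert = solve 3 (λ x y z → x :+ (y :+ z) := y :+ (x :+ z)) refl
      -- The identity term is spent here. As `t` does not recur and no other generator swaps, the
      -- rest is termwise.
      ... | inj₂ t-swaps = ≤-trans (≤-reflexive (trans (sym (+-assoc _ _ _)) (+-congʳ (+-congˡ (*-congˡ (proj₂ (swap t t-swaps)))))))
        (≤-trans (+-mono (rearrangement (p≤pid t) B≤A) (sum-mono (All.map rest t∉ts)))
          (≤-reflexive (trans (+-congʳ (+-congˡ (*-congˡ (sym (proj₁ (swap t t-swaps)))))) (+-assoc _ _ _))))
        where
        rest : ∀ {u} → t ≢ u → (p u * b u) ≤F (p u * a u)
        rest {u} t≢u with cases u
        ... | inj₁ b≤a     = *-monoˡ (0≤p u) b≤a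
        ... | inj₂ u-swaps = contradiction (unique t u t-swaps u-swaps) t≢u

      prob-ascent : ∀ n w s → ρ w (s ∷ []) ≡ false → prob n (w ++ s ∷ []) ≤F prob n w
      prob-ascent zero w s up = ≤-trans (≤-reflexive (reflexive (prob-sum 0 (w ++ s ∷ []))))
        (≤-trans (+-mono ind≤ ≤-refl) (≤-reflexive (reflexive (≡.sym (prob-sum 0 w)))))
        where
        ind≤ : ind (dec [] (w ++ s ∷ [])) 1# ≤F ind (dec [] w) 1#
        ind≤ with dec [] (w ++ s ∷ []) | dec [] w
        ... | no _  | no _  = ≤-refl
        ... | no _  | yes _ = 0≤1
        ... | yes _ | yes _ = ≤-refl
        -- If ws = 1 then w = s, for which the parity is odd.
        ... | yes e | no _  = contradiction (≡.trans (≡.sym (ρ-generator w≈s)) up) λ ()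
          where
          w≈s : w ≈W (s ∷ [])
          w≈s = ≈trans (≈sym (snoc-cancel w s)) (++-congʳ (s ∷ []) (≈sym e))
      prob-ascent (suc n) w s up = ≤-trans (≤-reflexive (prob-suc n (w ++ s ∷ [])))
        (≤-trans
          (sum-exchange (prob-ascent n w s up) (λ t → prob n (t ∷ w)) (λ t → prob n (t ∷ w ++ s ∷ []))
            Swap cases swap unique (allFin⁺ k))
          (≤-reflexive (sym (prob-suc n w))))
        where
        Swap : Fin k → Set
        Swap t = (t ∷ w) ≈W (w ++ s ∷ [])

        cases : ∀ t → prob n (t ∷ w ++ s ∷ []) ≤F prob n (t ∷ w) ⊎ Swap t
        cases t with dec (t ∷ w) (w ++ s ∷ [])
        ... | yes e = inj₂ e
        -- Prefixing `t` adds to the parity only the term tw = ws, which fails here, so tw is again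
        -- an ascent.
        ... | no ¬e = inj₁ (prob-ascent n (t ∷ w) s
          (≡.cong₂ _xor_ (dec-false (dec (t ∷ w) (w ++ s ∷ [])) ¬e) up))

        swap : ∀ t → Swap t → prob n (t ∷ w) ≈ prob n (w ++ s ∷ []) × prob n (t ∷ w ++ s ∷ []) ≈ prob n w
        swap t e = reflexive (prob-cong n e) ,
          reflexive (prob-cong n (≈trans (++-congʳ (s ∷ []) e) (snoc-cancel w s)))

        unique : ∀ t u → Swap t → Swap u → t ≡ u
        -- From tw = ws = uw, cancelling w leaves t = u in W.
        unique t u e d = generators-distinct t u (++-cancelʳ w (≈trans e (≈sym d)))

      -- The letters of `v` are appended one at a time, each being an ascent because the whole word
      -- is reduced.
      prob-prefix : ∀ n u v → Reduced (u ++ v) → prob n (u ++ v) ≤F prob n u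
      prob-prefix n u []      red = ≤-reflexive (reflexive (≡.cong (prob n) (++-identityʳ u)))
      prob-prefix n u (s ∷ v) red = ≤-trans
        (≡.subst (λ x → prob n x ≤F prob n (u ++ s ∷ [])) (++-assoc u (s ∷ []) v)
          (prob-prefix n (u ++ s ∷ []) v (≡.subst Reduced (≡.sym (++-assoc u (s ∷ []) v)) red)))
        (prob-ascent n u s (reduced⇒ascent u s v red))

theorem3p7 : {c ℓ : Level} (F : OrderedField c ℓ) {k : ℕ} (M : CoxeterMatrix k)
  → let open OrderedField F
        open Coxeter M
        open Walk F M
    in (p : Fin k → Carrier) (pid : Carrier)
       → (∀ s → 0# ≤F p s) → 0# ≤F pid
       → (pid + sumF (map p (allFin k))) ≈ 1#
       → (∀ s → p s <F pid)
       → (dec : ∀ u v → Dec (u ≈W v))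
       → ∀ (n : ℕ) (w w' : Word) → w ≤B w' → P p pid dec n w' ≤F P p pid dec n w
theorem3p7 F M p pid 0≤p 0≤pid _ p<pid dec n w w' (u , v , u≈w , uv≈w' , red) =
  ≡.subst₂ _≤F_ (prob-cong p pid dec n uv≈w') (prob-cong p pid dec n u≈w)
    (prob-prefix p pid dec 0≤p 0≤pid (λ s → proj₁ (p<pid s)) n u v red)
  where
  open OrderedField F using (_≤F_)
  open WalkProperties F M
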